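{- Let $n\ge 1$. The Zeckendorf game on $n$, starting from $\{F_1^n\}$, can be played to its end (the Zeckendorf decomposition of $n$) using only splitting moves and $C_1$ moves if and only if $n=F_k-1$ for some integer $k\ge 2$.
   Context: Fibonacci numbers are indexed by $F_1=1$, $F_2=2$, $F_{i+1}=F_i+F_{i-1}$. A game state is a finite multiset of Fibonacci numbers (tracked by index); $\{F_1^n\}$ denotes $n$ copies of $F_1$. The legal moves are: $C_1$: replace $F_1,F_1$ by $F_2$; for $i\ge 2$, $C_i$: replace $F_{i-1},F_i$ by $F_{i+1}$ (a "combining move"); $S_2$: replace $F_2,F_2$ by $F_1,F_3$; for $i\ge 3$, $S_i$: replace $F_i,F_i$ by $F_{i-2},F_{i+1}$ (a "splitting move"). The game on $n$ starts at $\{F_1^n\}$ and ends when no legal move is available, which happens exactly at the Zeckendorf decomposition of $n$ (the unique representation of $n$ as a sum of $F_i$'s with distinct, pairwise non-consecutive indices). -}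

module Defs where

open import Data.Nat using (ℕ; zero; suc; _+_; _∸_; _≤_; z≤n; s≤s; ∣_-_∣)
open import Data.Nat.ListAction using (sum)
open import Data.Nat.ListAction.Properties using (sum-↭; sum-++)
open import Data.Nat.Properties using (∣n-n∣≡0; ∣-∣-comm; _≤?_)
open import Data.Nat.Tactic.RingSolver using (solve-∀)
open import Data.List using (List; []; _∷_; _++_; map; replicate)
open import Data.List.Properties using (map-++)
open import Data.List.Membership.Propositional using (_∈_)
open import Data.List.Membership.Propositional.Properties using (∈-∃++)
open import Data.List.Relation.Unary.All using (All; []; _∷_; tabulate; lookup)
open import Data.List.Relation.Unary.All.Properties using (++⁺; ++⁻ʳ)
open import Data.List.Relation.Unary.AllPairs using (AllPairs; []; _∷_)
open import Data.List.Relation.Binary.Permutation.Propositional using (_↭_; ↭-refl; ↭-sym; ↭-trans; prep; swap; ↭⇒↭ₛ)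
open import Data.List.Relation.Binary.Permutation.Propositional.Properties using (map⁺; All-resp-↭; shift)
open import Data.List.Relation.Binary.Permutation.Setoid.Properties using (AllPairs-resp-↭)
open import Data.Product using (_×_; _,_; ∃-syntax)
open import Data.Sum using (_⊎_; inj₁; inj₂)
open import Function.Bundles using (_⇔_; mk⇔)
open import Relation.Binary.Construct.Closure.ReflexiveTransitive using (Star; ε; _◅_)
open import Relation.Binary.PropositionalEquality using (_≡_; refl; sym; trans; cong; subst; setoid; resp₂)
open import Relation.Nullary using (¬_; yes; no; contradiction)

-- Indexed so that F 1 = 1 and F 2 = 2. The index 0 lies outside the game;
-- F 0 = 1 is the value that makes the recurrence give F 2 = 2.
F : ℕ → ℕ
F zero          = 1
F (suc zero)    = 1
F (suc (suc i)) = F (suc i) + F i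

-- A multiset of Fibonacci numbers, as the list of their indices. The order
-- carries no information: moves are taken up to permutation.
State : Set
State = List ℕ

start : ℕ → State
start n = replicate n 1

data Move : Set where
  C₁ : Move
  C  : (i : ℕ) → 2 ≤ i → Move
  S₂ : Move
  S  : (i : ℕ) → 3 ≤ i → Move

removed : Move → List ℕ
removed C₁      = 1 ∷ 1 ∷ []
removed (C i _) = i ∸ 1 ∷ i ∷ []
removed S₂      = 2 ∷ 2 ∷ []
removed (S i _) = i ∷ i ∷ []

added : Move → List ℕ
added C₁      = 2 ∷ []
added (C i _) = suc i ∷ []
added S₂      = 1 ∷ 3 ∷ []
added (S i _) = i ∸ 2 ∷ suc i ∷ []

data IsSplitting : Move → Set where
  S₂ : IsSplitting S₂
  S  : (i : ℕ) (3≤i : 3 ≤ i) → IsSplitting (S i 3≤i)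

_—[_]→_ : State → Move → State → Set
s —[ m ]→ t = ∃[ rest ] (s ↭ removed m ++ rest × t ↭ added m ++ rest)

Terminal : State → Set
Terminal s = ∀ m t → ¬ (s —[ m ]→ t)

PlayUsing : (Move → Set) → State → State → Set
PlayUsing P = Star (λ s t → ∃[ m ] (P m × s —[ m ]→ t))

CanFinishUsing : (Move → Set) → ℕ → Set
CanFinishUsing P n = ∃[ t ] (PlayUsing P (start n) t × Terminal t)

SplittingOrC₁ : Move → Set
SplittingOrC₁ m = IsSplitting m ⊎ m ≡ C₁

IsZeckendorf : ℕ → State → Set
IsZeckendorf n s = All (1 ≤_) s × sum (map F s) ≡ n × AllPairs (λ i j → 2 ≤ ∣ i - j ∣) s

-- The two descriptions of the end of the game agree: a position reached from
-- start n is terminal exactly when it is the Zeckendorf decomposition of n.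

private
  Apart : ℕ → ℕ → Set
  Apart i j = 2 ≤ ∣ i - j ∣

  value : List ℕ → ℕ
  value s = sum (map F s)

  value-++ : ∀ s t → value (s ++ t) ≡ value s + value t
  value-++ s t = trans (cong sum (map-++ F s t)) (sum-++ (map F s) (map F t))

  value-↭ : ∀ {s t} → s ↭ t → value s ≡ value t
  value-↭ p = sum-↭ (map⁺ F p)

  value-move : ∀ m → value (removed m) ≡ value (added m)
  value-move C₁ = refl
  value-move (C (suc (suc i)) _) = combine (F i) (F (suc i))
    where
    combine : ∀ a b → b + (b + a + 0) ≡ b + a + b + 0
    combine = solve-∀
  value-move S₂ = refl
  value-move (S (suc (suc (suc i))) _) = split (F i) (F (suc i))
    where
    split : ∀ a b → (b + a + b) + (b + a + b + 0) ≡ b + (b + a + b + (b + a) + 0)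
    split = solve-∀
  value-move (C (suc zero) (s≤s ()))
  value-move (S (suc zero) (s≤s ()))
  value-move (S (suc (suc zero)) (s≤s (s≤s ())))

  value-step : ∀ {s t} m → s —[ m ]→ t → value s ≡ value t
  value-step m (r , p , q) = trans (value-↭ p) (trans (value-++ (removed m) r)
    (trans (cong (_+ value r) (value-move m)) (sym (trans (value-↭ q) (value-++ (added m) r)))))

  added-positive : ∀ m → All (1 ≤_) (added m)
  added-positive C₁ = s≤s z≤n ∷ []
  added-positive (C i _) = s≤s z≤n ∷ []
  added-positive S₂ = s≤s z≤n ∷ s≤s z≤n ∷ []
  added-positive (S _ (s≤s (s≤s (s≤s z≤n)))) = s≤s z≤n ∷ s≤s z≤n ∷ []

  positive-step : ∀ {s t} m → s —[ m ]→ t → All (1 ≤_) s → All (1 ≤_) t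
  positive-step m (r , p , q) pos =
    All-resp-↭ (↭-sym q) (++⁺ (added-positive m) (++⁻ʳ (removed m) (All-resp-↭ p pos)))

  play-invariant : ∀ {P s t} → PlayUsing P s t → All (1 ≤_) s → All (1 ≤_) t × value s ≡ value t
  play-invariant ε pos = pos , refl
  play-invariant ((m , _ , st) ◅ play) pos with play-invariant play (positive-step m st pos)
  ... | pos′ , eq = pos′ , trans (value-step m st) eq

  start-positive : ∀ n → All (1 ≤_) (start n)
  start-positive zero    = []
  start-positive (suc n) = s≤s z≤n ∷ start-positive n

  start-value : ∀ n → value (start n) ≡ n
  start-value zero    = refl
  start-value (suc n) = cong suc (start-value n)

  Apart-sym : ∀ i j → Apart i j → Apart j i
  Apart-sym i j = subst (2 ≤_) (∣-∣-comm i j)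

  apart-resp-↭ : ∀ {s t} → s ↭ t → AllPairs Apart s → AllPairs Apart t
  apart-resp-↭ p = AllPairs-resp-↭ (setoid ℕ) (λ {i} {j} → Apart-sym i j) (resp₂ Apart) (↭⇒↭ₛ p)

  ¬apart-self : ∀ i → ¬ Apart i i
  ¬apart-self i a with subst (2 ≤_) (∣n-n∣≡0 i) a
  ... | ()

  ¬apart-suc : ∀ i → ¬ Apart i (suc i)
  ¬apart-suc zero    (s≤s ())
  ¬apart-suc (suc i) a = ¬apart-suc i a

  ¬apart-removed : ∀ m r → ¬ AllPairs Apart (removed m ++ r)
  ¬apart-removed C₁            r ((a ∷ _) ∷ _) = ¬apart-self 1 a
  ¬apart-removed (C (suc i) _) r ((a ∷ _) ∷ _) = ¬apart-suc i a
  ¬apart-removed S₂            r ((a ∷ _) ∷ _) = ¬apart-self 2 a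
  ¬apart-removed (S i _)       r ((a ∷ _) ∷ _) = ¬apart-self i a

  ¬apart⇒close : ∀ i j → ¬ Apart i j → i ≡ j ⊎ j ≡ suc i ⊎ i ≡ suc j
  ¬apart⇒close zero zero _ = inj₁ refl
  ¬apart⇒close zero (suc zero) _ = inj₂ (inj₁ refl)
  ¬apart⇒close zero (suc (suc j)) na = contradiction (s≤s (s≤s z≤n)) na
  ¬apart⇒close (suc zero) zero _ = inj₂ (inj₂ refl)
  ¬apart⇒close (suc (suc i)) zero na = contradiction (s≤s (s≤s z≤n)) na
  ¬apart⇒close (suc i) (suc j) na with ¬apart⇒close i j na
  ... | inj₁ refl        = inj₁ refl
  ... | inj₂ (inj₁ refl) = inj₂ (inj₁ refl)
  ... | inj₂ (inj₂ refl) = inj₂ (inj₂ refl)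

  terminal-self : ∀ {s r} i → 1 ≤ i → s ↭ i ∷ i ∷ r → ¬ Terminal s
  terminal-self (suc zero) _ p T = T C₁ _ (_ , p , ↭-refl)
  terminal-self (suc (suc zero)) _ p T = T S₂ _ (_ , p , ↭-refl)
  terminal-self (suc (suc (suc i))) _ p T = T (S _ (s≤s (s≤s (s≤s z≤n)))) _ (_ , p , ↭-refl)

  terminal-suc : ∀ {s r} i → 1 ≤ i → s ↭ i ∷ suc i ∷ r → ¬ Terminal s
  terminal-suc i 1≤i p T = T (C (suc i) (s≤s 1≤i)) _ (_ , p , ↭-refl)

  terminal-tail : ∀ {i s} → Terminal (i ∷ s) → Terminal s
  terminal-tail {i} T m t (r , p , _) =
    T m (added m ++ i ∷ r) (i ∷ r , ↭-trans (prep i p) (↭-sym (shift i (removed m) r)) , ↭-refl)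

  terminal-apart : ∀ {s} → All (1 ≤_) s → Terminal s → AllPairs Apart s
  terminal-apart [] T = []
  terminal-apart {i ∷ s} (1≤i ∷ pos) T = tabulate apart ∷ terminal-apart pos (terminal-tail T)
    where
    apart : ∀ {j} → j ∈ s → Apart i j
    apart {j} j∈s with 2 ≤? ∣ i - j ∣
    ... | yes a = a
    ... | no na with ∈-∃++ j∈s | ¬apart⇒close i j na
    ... | xs , ys , refl | inj₁ refl = contradiction T
          (terminal-self i 1≤i (prep i (shift i xs ys)))
    ... | xs , ys , refl | inj₂ (inj₁ refl) = contradiction T
          (terminal-suc i 1≤i (prep i (shift (suc i) xs ys)))
    ... | xs , ys , refl | inj₂ (inj₂ refl) = contradiction T
          (terminal-suc j (lookup pos j∈s) (↭-trans (prep i (shift j xs ys)) (swap i j ↭-refl)))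

terminal⇔zeckendorf : ∀ {P n t} → PlayUsing P (start n) t → Terminal t ⇔ IsZeckendorf n t
terminal⇔zeckendorf {n = n} play with play-invariant play (start-positive n)
... | pos , eq = mk⇔
  (λ T → pos , trans (sym eq) (start-value n) , terminal-apart pos T)
  (λ { (_ , _ , ap) m _ (r , p , _) → ¬apart-removed m r (apart-resp-↭ p ap) })

{-# OPTIONS --safe #-}

-- With only splitting moves and C₁ the game is a chip-firing game: a move takes
-- two chips from its site i and gives one chip to each of its out-neighbours.
--
-- Only if.  At any time, a nonempty set A of sites that have all fired contains
-- a site x holding at least as many chips as x has in-neighbours in A: take the
-- site of A whose last firing is the earliest, since each in-neighbour in A has
-- sent it a chip afterwards.  If the final position had a chip above r while
-- the sites r - 1 and r were empty, A = {1, …, r} would violate this: r - 1 and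
-- r have an in-neighbour in A, while the other sites have two and hold at most
-- one chip.  So the final position is {K, K - 2, …}, of value F (K + 1) - 1.
--
-- If.  As F (K + 3) - 1 = 1 + (F (K + 2) - 1) + (F (K + 1) - 1), induction plays
-- the start to {1} ∪ {K + 1, K - 1, …} ∪ {K, K - 2, …} = {1, 1, 2, …, K + 1}.
-- Firing 1, 2, …, K + 1 in this order gives {K + 2} ∪ {1, 1, 2, …, K - 1}, and
-- repeating this on the second part ends at {K + 2, K, …}.

module Submission where

open import Defs
open import Data.Bool using (Bool; true; false; if_then_else_)
open import Data.Empty using (⊥; ⊥-elim)
open import Data.List using ([]; _∷_; _++_; map)
open import Data.List.Properties using (map-++; ++-assoc)
open import Data.List.Membership.Propositional using (_∈_; _∉_)
open import Data.List.Membership.Propositional.Properties using (∈-∃++; ∈-++⁻)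
open import Data.List.Membership.DecPropositional using (_∈?_)
open import Data.List.Relation.Binary.Permutation.Propositional using (_↭_; ↭-refl; ↭-reflexive; ↭-sym; ↭-trans; prep; swap; ↭⇒↭ₛ)
open import Data.List.Relation.Binary.Permutation.Propositional.Properties using (map⁺; All-resp-↭; ∈-resp-↭; ++⁺ʳ; ++-comm; shift)
open import Data.List.Relation.Binary.Permutation.Setoid.Properties using (AllPairs-resp-↭)
open import Data.List.Relation.Unary.All as All using (All; []; _∷_)
open import Data.List.Relation.Unary.AllPairs using (AllPairs; []; _∷_)
open import Data.List.Relation.Unary.Any using (here; there)
open import Data.Nat using (ℕ; zero; suc; _+_; _≤_; _<_; _∸_; z≤n; s≤s; s≤s⁻¹; ∣_-_∣; _<ᵇ_; _≟_; _≤?_)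
open import Data.Nat.ListAction using (sum)
open import Data.Nat.ListAction.Properties using (sum-↭; sum-++)
open import Data.Nat.Properties
open import Algebra.Properties.CommutativeSemigroup +-commutativeSemigroup using () renaming (interchange to +-interchange)
open import Data.Product using (_×_; _,_; proj₂; ∃-syntax)
open import Data.Sum using (_⊎_; inj₁; inj₂; [_,_]′)
open import Function.Base using (_∘_; id)
open import Function.Bundles using (_⇔_; mk⇔; Equivalence)
open import Relation.Binary.Construct.Closure.ReflexiveTransitive using (ε; _◅_; _◅◅_; gmap)
open import Relation.Binary.PropositionalEquality using (_≡_; _≢_; refl; sym; trans; cong; cong₂; subst; setoid; resp₂; module ≡-Reasoning)
open import Relation.Nullary using (¬_; yes; no; contradiction)

-- Values and distances between indices

value : State → ℕ
value s = sum (map F s)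

Apart : ℕ → ℕ → Set
Apart i j = 2 ≤ ∣ i - j ∣

apart-resp-↭ : ∀ {s t} → s ↭ t → AllPairs Apart s → AllPairs Apart t
apart-resp-↭ p = AllPairs-resp-↭ (setoid ℕ)
  (λ {i} {j} → subst (2 ≤_) (∣-∣-comm i j)) (resp₂ Apart) (↭⇒↭ₛ p)

apart⇒2+≤ : ∀ {i j} → j ≤ i → Apart i j → 2 + j ≤ i
apart⇒2+≤ {i} {j} j≤i a =
  ≤-trans (+-monoˡ-≤ j (subst (2 ≤_) (m≤n⇒∣n-m∣≡n∸m j≤i) a)) (≤-reflexive (m∸n+n≡m j≤i))

2+≤⇒apart : ∀ {i j} → 2 + j ≤ i → Apart i j
2+≤⇒apart {i} {j} 2+j≤i = subst (2 ≤_) (sym (m≤n⇒∣n-m∣≡n∸m (m+n≤o⇒n≤o 2 2+j≤i)))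
  (≤-trans (≤-reflexive (sym (m+n∸n≡m 2 j))) (∸-monoˡ-≤ j 2+j≤i))

¬apart-self : ∀ i → ¬ Apart i i
¬apart-self i a = <-irrefl refl (≤-trans (n≤1+n _) (apart⇒2+≤ {i} ≤-refl a))

-- The positions {K, K - 2, K - 4, …}

zeck : ℕ → State
zeck 0             = []
zeck 1             = 1 ∷ []
zeck (suc (suc K)) = suc (suc K) ∷ zeck K

zeck-≤ : ∀ K → All (_≤ K) (zeck K)
zeck-≤ 0             = []
zeck-≤ 1             = ≤-refl ∷ []
zeck-≤ (suc (suc K)) = ≤-refl ∷ All.map (m≤n⇒m≤o+n 2) (zeck-≤ K)

zeck-positive : ∀ K → All (1 ≤_) (zeck K)
zeck-positive 0             = []
zeck-positive 1             = ≤-refl ∷ []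
zeck-positive (suc (suc K)) = s≤s z≤n ∷ zeck-positive K

zeck-apart : ∀ K → AllPairs Apart (zeck K)
zeck-apart 0             = []
zeck-apart 1             = [] ∷ []
zeck-apart (suc (suc K)) = All.map (2+≤⇒apart ∘ +-monoʳ-≤ 2) (zeck-≤ K) ∷ zeck-apart K

-- The recurrence of `F` absorbs the top index at each step. The `suc` on the left avoids truncated
-- subtraction.
zeck-value : ∀ K → suc (value (zeck K)) ≡ F (suc K)
zeck-value 0             = refl
zeck-value 1             = refl
zeck-value (suc (suc K)) =
  trans (sym (+-suc (F (suc (suc K))) _)) (cong (F (suc (suc K)) +_) (zeck-value K))

-- Positions without two adjacent empty sites

Dense : ℕ → State → Set
Dense K s = ∀ r → 1 ≤ r → suc r < K → r ∈ s ⊎ suc r ∈ s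

∈-∷-< : ∀ {i j s} → j < i → j ∈ i ∷ s → j ∈ s
∈-∷-< j<i (here refl) = contradiction j<i (<-irrefl refl)
∈-∷-< _   (there j∈s) = j∈s

mutual
  -- `Apart` makes consecutive gaps at least two and `Dense` makes them at most two, so the position
  -- is determined by its maximum. The maximum is split off here, and `dense-∷⇒zeck` finds the next
  -- one two below it.
  dense⇒zeck : ∀ K {s} → All (1 ≤_) s → AllPairs Apart s → All (_≤ suc K) s →
               suc K ∈ s → Dense (suc K) s → s ↭ zeck (suc K)
  dense⇒zeck K pos apart bounded K∈s dense with ∈-∃++ K∈s
  ... | xs , ys , refl
    with p ← shift (suc K) xs ys
    with _ ∷ pos′ ← All-resp-↭ p pos | K-apart ∷ apart′ ← apart-resp-↭ p apart
       | _ ∷ bounded′ ← All-resp-↭ p bounded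
    = ↭-trans p (dense-∷⇒zeck K pos′ apart′
        (All.zipWith (λ (j≤K , a) → apart⇒2+≤ j≤K a) (bounded′ , K-apart))
        (λ r 1≤r r<K → [ inj₁ ∘ ∈-resp-↭ p , inj₂ ∘ ∈-resp-↭ p ]′ (dense r 1≤r r<K)))

  dense-∷⇒zeck : ∀ K {s} → All (1 ≤_) s → AllPairs Apart s → All (λ j → 2 + j ≤ suc K) s →
                 Dense (suc K) (suc K ∷ s) → suc K ∷ s ↭ zeck (suc K)
  dense-∷⇒zeck 0 {[]}    _ _ _ _ = ↭-refl
  dense-∷⇒zeck 0 {_ ∷ _} _ _ (s≤s () ∷ _) _
  dense-∷⇒zeck 1 {[]}    _ _ _ _ = ↭-refl
  dense-∷⇒zeck 1 {_ ∷ _} (s≤s _ ∷ _) _ (s≤s (s≤s ()) ∷ _) _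
  dense-∷⇒zeck (suc (suc K)) {s} pos apart bounded dense =
    prep _ (dense⇒zeck K pos apart (All.map (s≤s⁻¹ ∘ s≤s⁻¹) bounded) K∈s dense′)
    where
    -- Of the pair `suc K`, `suc (suc K)`, the second is too close to the head `3 + K`.
    K∈s : suc K ∈ s
    K∈s with dense (suc K) (s≤s z≤n) ≤-refl
    ... | inj₁ K∈      = ∈-∷-< (n≤1+n _) K∈
    ... | inj₂ 1+K∈ with () ← <-irrefl refl (s≤s⁻¹ (All.lookup bounded (∈-∷-< ≤-refl 1+K∈)))

    dense′ : Dense (suc K) s
    dense′ r 1≤r r<K with dense r 1≤r (m≤n⇒m≤o+n 2 r<K)
    ... | inj₁ r∈   = inj₁ (∈-∷-< (m≤n⇒m≤o+n 2 (<-trans ≤-refl r<K)) r∈)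
    ... | inj₂ 1+r∈ = inj₂ (∈-∷-< (m≤n⇒m≤o+n 2 r<K) 1+r∈)

-- Forbidden sets of sites

-- The Kronecker delta, recursive in both arguments so that common successors cancel by computation,
-- as `indegree-∖` needs.
δ : ℕ → ℕ → ℕ
δ zero    zero    = 1
δ zero    (suc _) = 0
δ (suc _) zero    = 0
δ (suc y) (suc x) = δ y x

δ-refl : ∀ y → δ y y ≡ 1
δ-refl zero    = refl
δ-refl (suc y) = δ-refl y

δ-≢ : ∀ {y x} → y ≢ x → δ y x ≡ 0
δ-≢ {zero}  {zero}  y≢x = contradiction refl y≢x
δ-≢ {zero}  {suc _} y≢x = refl
δ-≢ {suc _} {zero}  y≢x = refl
δ-≢ {suc y} {suc x} y≢x = δ-≢ (y≢x ∘ cong suc)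

count : ℕ → State → ℕ
count y s = sum (map (δ y) s)

count-++ : ∀ y s t → count y (s ++ t) ≡ count y s + count y t
count-++ y s t = trans (cong sum (map-++ (δ y) s t)) (sum-++ (map (δ y) s) _)

count-↭ : ∀ y {s t} → s ↭ t → count y s ≡ count y t
count-↭ y p = sum-↭ (map⁺ (δ y) p)

count-∉ : ∀ {y} s → y ∉ s → count y s ≡ 0
count-∉ []      _   = refl
count-∉ (x ∷ s) y∉ = cong₂ _+_ (δ-≢ (y∉ ∘ here)) (count-∉ s (y∉ ∘ there))

count-apart : ∀ y {s} → AllPairs Apart s → count y s ≤ 1
count-apart y [] = z≤n
count-apart y {x ∷ s} (x-apart ∷ apart) with y ≟ x
... | yes refl = ≤-reflexive (cong₂ _+_ (δ-refl y)
                   (count-∉ s (λ y∈s → ¬apart-self y (All.lookup x-apart y∈s))))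
... | no y≢x   = subst (_≤ 1) (cong (_+ count y s) (sym (δ-≢ y≢x))) (count-apart y apart)

-- Boolean membership can be summed in `indegree` and decided by a `with`.
SiteSet : Set
SiteSet = ℕ → Bool

_∋_ : SiteSet → ℕ → Set
A ∋ x = A x ≡ true

_∖_ : SiteSet → ℕ → SiteSet
(A ∖ i) j with j ≟ i
... | yes _ = false
... | no _  = A j

∖-∋⁺ : ∀ A {i j} → j ≢ i → A ∋ j → (A ∖ i) ∋ j
∖-∋⁺ A {i} {j} j≢i j∈A with j ≟ i
... | yes j≡i = contradiction j≡i j≢i
... | no _    = j∈A

∖-∋⁻ : ∀ A {i j} → (A ∖ i) ∋ j → j ≢ i × A ∋ j
∖-∋⁻ A {i} {j} j∈ with j ≟ i
... | no j≢i = j≢i , j∈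

𝟙 : Bool → ℕ
𝟙 b = if b then 1 else 0

𝟙-∖ : ∀ A i j → 𝟙 (A j) ≤ 𝟙 ((A ∖ i) j) + δ j i
𝟙-∖ A i j with j ≟ i
... | no _ = m≤m+n _ _
... | yes refl rewrite δ-refl j with A j
... | true  = ≤-refl
... | false = z≤n

-- A move at the site i ≥ 3 feeds i - 2 and i + 1, one at 2 feeds 1 and 3, and
-- C₁ at the site 1 feeds 2.
indegree : SiteSet → ℕ → ℕ
indegree A 0             = 0
indegree A 1             = 𝟙 (A 2) + 𝟙 (A 3)
indegree A 2             = 𝟙 (A 1) + 𝟙 (A 4)
indegree A (suc (suc y)) = 𝟙 (A (suc y)) + 𝟙 (A (4 + y))

𝟙-pair⁻ : ∀ A {i j n} → n < 𝟙 (A i) + 𝟙 (A j) → A ∋ i ⊎ A ∋ j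
𝟙-pair⁻ A {i} {j} n< with A i in Ai | A j in Aj
... | true  | _    = inj₁ refl
... | false | true = inj₂ refl

-- No site feeds itself. Hence a forbidden set stays nonempty when one of its sites is removed.
in-neighbour : ∀ A y {n} → n < indegree A y → ∃[ x ] (x ≢ y × A ∋ x)
in-neighbour A 1 n< =
  [ (λ x∈A → 2 , (λ ()) , x∈A) , (λ x∈A → 3 , (λ ()) , x∈A) ]′ (𝟙-pair⁻ A n<)
in-neighbour A 2 n< =
  [ (λ x∈A → 1 , (λ ()) , x∈A) , (λ x∈A → 4 , (λ ()) , x∈A) ]′ (𝟙-pair⁻ A n<)
in-neighbour A (suc (suc (suc y))) n< =
  [ (λ x∈A → _ , <⇒≢ ≤-refl , x∈A) , (λ x∈A → _ , >⇒≢ (n≤1+n _) , x∈A) ]′ (𝟙-pair⁻ A n<)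

-- Moves as firings of a site

site : Move → ℕ
site C₁      = 1
site (C i _) = i
site S₂      = 2
site (S i _) = i

removed-site : ∀ {m} → SplittingOrC₁ m → removed m ≡ site m ∷ site m ∷ []
removed-site (inj₁ S₂)      = refl
removed-site (inj₁ (S _ _)) = refl
removed-site (inj₂ refl)    = refl

added-≤ : ∀ m → All (_≤ suc (site m)) (added m)
added-≤ C₁      = ≤-refl ∷ []
added-≤ (C i _) = ≤-refl ∷ []
added-≤ S₂      = s≤s z≤n ∷ ≤-refl ∷ []
added-≤ (S i _) = m≤n⇒m≤1+n (m∸n≤m i 2) ∷ ≤-refl ∷ []

𝟙-pair-∖ : ∀ A i x y {a} → δ x i + δ y i ≤ a →
           𝟙 (A x) + 𝟙 (A y) ≤ 𝟙 ((A ∖ i) x) + 𝟙 ((A ∖ i) y) + a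
𝟙-pair-∖ A i x y {a} δ≤a = begin
  𝟙 (A x) + 𝟙 (A y)
    ≤⟨ +-mono-≤ (𝟙-∖ A i x) (𝟙-∖ A i y) ⟩
  𝟙 ((A ∖ i) x) + δ x i + (𝟙 ((A ∖ i) y) + δ y i)
    ≡⟨ +-interchange (𝟙 ((A ∖ i) x)) (δ x i) _ (δ y i) ⟩
  𝟙 ((A ∖ i) x) + 𝟙 ((A ∖ i) y) + (δ x i + δ y i)
    ≤⟨ +-monoʳ-≤ _ δ≤a ⟩
  𝟙 ((A ∖ i) x) + 𝟙 ((A ∖ i) y) + a ∎
  where open ≤-Reasoning

-- Removing the fired site from `A` can cost `y` only the edges from that site to `y`, and along
-- each of these the move sends `y` a chip. The local `fed` checks this edge count for each move.
indegree-∖ : ∀ A {m} → SplittingOrC₁ m → ∀ y →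
             indegree A y ≤ indegree (A ∖ site m) y + count y (added m)
indegree-∖ A {m} ok 0 = z≤n
indegree-∖ A {m} ok 1 = 𝟙-pair-∖ A (site m) 2 3 (fed ok)
  where
  fed : ∀ {m} → SplittingOrC₁ m → δ 2 (site m) + δ 3 (site m) ≤ count 1 (added m)
  fed (inj₁ S₂) = ≤-refl
  fed (inj₁ (S (suc (suc (suc 0))) _)) = ≤-refl
  fed (inj₁ (S (suc (suc (suc (suc i)))) _)) = z≤n
  fed (inj₁ (S 1 (s≤s ())))
  fed (inj₁ (S 2 (s≤s (s≤s ()))))
  fed (inj₂ refl) = z≤n
indegree-∖ A {m} ok 2 = 𝟙-pair-∖ A (site m) 1 4 (fed ok)
  where
  fed : ∀ {m} → SplittingOrC₁ m → δ 1 (site m) + δ 4 (site m) ≤ count 2 (added m)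
  fed (inj₁ S₂) = z≤n
  fed (inj₁ (S (suc (suc (suc i))) _)) = m≤m+n _ _
  fed (inj₁ (S 1 (s≤s ())))
  fed (inj₁ (S 2 (s≤s (s≤s ()))))
  fed (inj₂ refl) = ≤-refl
indegree-∖ A {m} ok (suc (suc (suc y))) = 𝟙-pair-∖ A (site m) (2 + y) (5 + y) (fed ok)
  where
  fed : ∀ {m} → SplittingOrC₁ m →
        δ (2 + y) (site m) + δ (5 + y) (site m) ≤ count (3 + y) (added m)
  fed (inj₁ S₂) = ≤-refl
  fed (inj₁ (S (suc (suc (suc i))) _)) = begin
    δ y (suc i) + δ (2 + y) i       ≡⟨ +-comm (δ y (suc i)) _ ⟩
    δ (2 + y) i + δ y (suc i)       ≡⟨ cong (δ (2 + y) i +_) (+-identityʳ (δ y (suc i))) ⟨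
    δ (2 + y) i + (δ y (suc i) + 0) ∎
    where open ≤-Reasoning
  fed (inj₁ (S 1 (s≤s ())))
  fed (inj₁ (S 2 (s≤s (s≤s ()))))
  fed (inj₂ refl) = z≤n

-- A nonempty set A is forbidden in s when every y ∈ A has count y s < indegree A y.
record FiringInvariant (Fired : ℕ → Set) (s : State) : Set where
  field
    fired-below : ∀ {p} → p ∈ s → ∀ {j} → 1 ≤ j → j < p → Fired j
    ¬forbidden  : ∀ A → (∀ {x} → A ∋ x → Fired x) → ∀ {x} → A ∋ x →
                  ¬ (∀ {y} → A ∋ y → count y s < indegree A y)

open FiringInvariant

start-invariant : ∀ n → FiringInvariant (λ _ → ⊥) (start n)
start-invariant n .fired-below p∈ 1≤j j<p = <-irrefl refl (≤-trans j<p (≤-trans (start-≤ n p∈) 1≤j))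
  where
  start-≤ : ∀ n {p} → p ∈ start n → p ≤ 1
  start-≤ (suc n) (here refl) = ≤-refl
  start-≤ (suc n) (there p∈)  = start-≤ n p∈
start-invariant n .¬forbidden A A⊆∅ x∈A _ = A⊆∅ x∈A

-- Induction over the moves replaces the choice of an earliest last firing. Let `A` be forbidden
-- after the move. If the fired site is outside `A`, no site of `A` lost chips, so `A` was forbidden
-- before. Otherwise `A` without that site was forbidden before, by `indegree-∖`.
step-invariant : ∀ {Fired s t} m → SplittingOrC₁ m → s —[ m ]→ t → FiringInvariant Fired s →
                 FiringInvariant (λ j → Fired j ⊎ j ≡ site m) t
step-invariant {Fired} {s} {t} m ok (rest , p , q) inv = record
  { fired-below = below
  ; ¬forbidden  = allowed
  }
  where
  i : ℕ
  i = site m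

  p′ : s ↭ i ∷ i ∷ rest
  p′ = ↭-trans p (↭-reflexive (cong (_++ rest) (removed-site ok)))

  below : ∀ {p} → p ∈ t → ∀ {j} → 1 ≤ j → j < p → Fired j ⊎ j ≡ i
  below x∈t {j} 1≤j j<x with ∈-++⁻ (added m) (∈-resp-↭ q x∈t)
  ... | inj₂ x∈rest = inj₁ (inv .fired-below (∈-resp-↭ (↭-sym p′) (there (there x∈rest))) 1≤j j<x)
  -- A new chip lies at most one site above `i`. The sites below `i` had fired already, since `i`
  -- was occupied, and `i` fires now.
  ... | inj₁ x∈added with j ≟ i
  ... | yes j≡i = inj₂ j≡i
  ... | no j≢i  = inj₁ (inv .fired-below (∈-resp-↭ (↭-sym p′) (here refl)) 1≤j
                    (≤∧≢⇒< (s≤s⁻¹ (≤-trans j<x (All.lookup (added-≤ m) x∈added))) j≢i))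

  count-step : ∀ {y} → y ≢ i → count y t ≡ count y s + count y (added m)
  count-step {y} y≢i = begin
    count y t                        ≡⟨ count-↭ y q ⟩
    count y (added m ++ rest)        ≡⟨ count-++ y (added m) rest ⟩
    count y (added m) + count y rest ≡⟨ +-comm (count y (added m)) _ ⟩
    count y rest + count y (added m)
      ≡⟨ cong (λ d → d + (d + count y rest) + count y (added m)) (δ-≢ y≢i) ⟨
    count y (i ∷ i ∷ rest) + count y (added m)
      ≡⟨ cong (_+ count y (added m)) (count-↭ y p′) ⟨
    count y s + count y (added m)    ∎
    where open ≡-Reasoning

  allowed : ∀ A → (∀ {x} → A ∋ x → Fired x ⊎ x ≡ i) → ∀ {x} → A ∋ x →
            ¬ (∀ {y} → A ∋ y → count y t < indegree A y)
  allowed A A⊆ x∈A forbidden with A i in Ai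
  ... | false = inv .¬forbidden A fired x∈A λ y∈A →
          ≤-<-trans (≤-trans (m≤m+n _ _) (≤-reflexive (sym (count-step (≢i y∈A))))) (forbidden y∈A)
    where
    ≢i : ∀ {y} → A ∋ y → y ≢ i
    ≢i y∈A refl with () ← trans (sym y∈A) Ai

    fired : ∀ {x} → A ∋ x → Fired x
    fired x∈A = [ id , (λ x≡i → contradiction x≡i (≢i x∈A)) ]′ (A⊆ x∈A)
  -- The forbidden condition at `i` itself yields the element `z` that remains in `A ∖ i`.
  ... | true with z , z≢i , z∈A ← in-neighbour A i (forbidden Ai) =
          inv .¬forbidden (A ∖ i) (λ {x} → fired {x}) {z} (∖-∋⁺ A z≢i z∈A) (λ {y} → forbidden′ {y})
    where
    fired : ∀ {x} → (A ∖ i) ∋ x → Fired x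
    fired {x} x∈ with x≢i , x∈A ← ∖-∋⁻ A {i} {x} x∈ = [ id , (λ x≡i → contradiction x≡i x≢i) ]′ (A⊆ x∈A)

    forbidden′ : ∀ {y} → (A ∖ i) ∋ y → count y s < indegree (A ∖ i) y
    forbidden′ {y} y∈ with y≢i , y∈A ← ∖-∋⁻ A {i} {y} y∈ =
      +-cancelʳ-< (count y (added m)) _ _ (begin-strict
        count y s + count y (added m)          ≡⟨ count-step y≢i ⟨
        count y t                              <⟨ forbidden y∈A ⟩
        indegree A y                           ≤⟨ indegree-∖ A ok y ⟩
        indegree (A ∖ i) y + count y (added m) ∎)
      where open ≤-Reasoning

play-invariant : ∀ {Fired s t} → PlayUsing SplittingOrC₁ s t → FiringInvariant Fired s →
                 ∃[ Fired′ ] FiringInvariant Fired′ t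
play-invariant ε                        inv = _ , inv
play-invariant ((m , ok , step) ◅ play) inv = play-invariant play (step-invariant m ok step inv)

-- Initial segments of sites as forbidden sets

upTo : ℕ → SiteSet
upTo r zero    = false
upTo r (suc x) = x <ᵇ r

upTo-∋⁺ : ∀ {r x} → 1 ≤ x → x ≤ r → upTo r ∋ x
upTo-∋⁺ {suc r} {suc zero}    _ _         = refl
upTo-∋⁺ {suc r} {suc (suc x)} _ (s≤s x<r) = upTo-∋⁺ {r} (s≤s z≤n) x<r

upTo-∋⁻ : ∀ {r x} → upTo r ∋ x → 1 ≤ x × x ≤ r
upTo-∋⁻ {suc r} {suc zero}    _  = s≤s z≤n , s≤s z≤n
upTo-∋⁻ {suc r} {suc (suc x)} x∈ = s≤s z≤n , s≤s (proj₂ (upTo-∋⁻ {r} {suc x} x∈))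

𝟙-upTo : ∀ {r x} → 1 ≤ x → x ≤ r → 𝟙 (upTo r x) ≡ 1
𝟙-upTo 1≤x x≤r = cong 𝟙 (upTo-∋⁺ 1≤x x≤r)

indegree-upTo-≥1 : ∀ {r y} → 2 ≤ r → 1 ≤ y → y ≤ r → 1 ≤ indegree (upTo r) y
indegree-upTo-≥1 {r} {y} 2≤r 1≤y y≤r = go y 1≤y y≤r
  where
  fed : ∀ {x n} → 1 ≤ x → x ≤ r → 1 ≤ 𝟙 (upTo r x) + n
  fed {n = n} 1≤x x≤r = subst (λ k → 1 ≤ k + n) (sym (𝟙-upTo 1≤x x≤r)) (s≤s z≤n)

  go : ∀ y → 1 ≤ y → y ≤ r → 1 ≤ indegree (upTo r) y
  go 1                   _ y≤r = fed {2} (s≤s z≤n) 2≤r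
  go 2                   _ y≤r = fed {1} (s≤s z≤n) (≤-trans (n≤1+n 1) 2≤r)
  go (suc (suc (suc y))) _ y≤r = fed {2 + y} (s≤s z≤n) (≤-trans (n≤1+n _) y≤r)

-- The higher of the two in-neighbours of `y` is always `2 + y`.
indegree-upTo-2 : ∀ {r y} → 1 ≤ y → 2 + y ≤ r → indegree (upTo r) y ≡ 2
indegree-upTo-2 {r} {1} _ y≤r =
  cong₂ _+_ (𝟙-upTo {r} {2} (s≤s z≤n) (≤-trans (n≤1+n _) y≤r)) (𝟙-upTo {r} {3} (s≤s z≤n) y≤r)
indegree-upTo-2 {r} {2} _ y≤r =
  cong₂ _+_ (𝟙-upTo {r} {1} (s≤s z≤n) (≤-trans (s≤s z≤n) y≤r)) (𝟙-upTo {r} {4} (s≤s z≤n) y≤r)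
indegree-upTo-2 {r} {suc (suc (suc y))} _ y≤r =
  cong₂ _+_ (𝟙-upTo {r} {2 + y} (s≤s z≤n) (≤-trans (m≤n+m _ 3) y≤r))
            (𝟙-upTo {r} {5 + y} (s≤s z≤n) y≤r)

-- Here the empty sites are `r` and `suc r`, so the forbidden set is {1, ..., r + 1}. All of it has
-- fired because it lies below the chip at `K`.
invariant⇒dense : ∀ {Fired K t} → FiringInvariant Fired t → AllPairs Apart t → K ∈ t → Dense K t
invariant⇒dense {t = t} inv apart K∈t r 1≤r r<K with _∈?_ _≟_ r t | _∈?_ _≟_ (suc r) t
... | yes r∈t | _         = inj₁ r∈t
... | no _    | yes 1+r∈t = inj₂ 1+r∈t
... | no r∉t  | no 1+r∉t  = ⊥-elim
        (inv .¬forbidden A (λ {x} → fired {x}) {1} (upTo-∋⁺ {suc r} ≤-refl (s≤s z≤n))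
          (λ {y} → forbidden {y}))
  where
  A : SiteSet
  A = upTo (suc r)

  fired : ∀ {x} → A ∋ x → _
  fired {x} x∈A with 1≤x , x≤r ← upTo-∋⁻ {suc r} {x} x∈A =
    inv .fired-below K∈t 1≤x (≤-<-trans x≤r r<K)

  empty : ∀ {y} → A ∋ y → y ∉ t → count y t < indegree A y
  empty {y} y∈A y∉t with 1≤y , y≤r ← upTo-∋⁻ {suc r} {y} y∈A =
    subst (_< indegree A y) (sym (count-∉ t y∉t)) (indegree-upTo-≥1 {suc r} {y} (s≤s 1≤r) 1≤y y≤r)

  forbidden : ∀ {y} → A ∋ y → count y t < indegree A y
  forbidden {y} y∈A with y ≟ r | y ≟ suc r
  ... | yes refl | _        = empty {y} y∈A r∉t
  ... | no _     | yes refl = empty {y} y∈A 1+r∉t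
  ... | no y≢r   | no y≢1+r with 1≤y , y≤1+r ← upTo-∋⁻ {suc r} {y} y∈A =
    subst (count y t <_)
      (sym (indegree-upTo-2 {suc r} {y} 1≤y (s≤s (≤∧≢⇒< (s≤s⁻¹ (≤∧≢⇒< y≤1+r y≢1+r)) y≢r))))
      (s≤s (count-apart y apart))

maximum : ∀ x s → ∃[ K ] (K ∈ x ∷ s × All (_≤ K) (x ∷ s))
maximum x []      = x , here refl , ≤-refl ∷ []
maximum x (y ∷ s) with maximum y s
... | K , K∈ , bounded with x ≤? K
... | yes x≤K = K , there K∈ , x≤K ∷ bounded
... | no x≰K  = x , here refl , ≤-refl ∷ All.map (λ j≤K → ≤-trans j≤K (≰⇒≥ x≰K)) bounded

finish⇒fibonacci : ∀ n → 1 ≤ n → CanFinishUsing SplittingOrC₁ n → ∃[ k ] (2 ≤ k × n ≡ F k ∸ 1)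
finish⇒fibonacci n 1≤n (t , play , terminal)
  with play-invariant play (start-invariant n) | Equivalence.to (terminal⇔zeckendorf play) terminal
finish⇒fibonacci n () (.[] , _) | _ | pos , refl , []
finish⇒fibonacci n 1≤n (x ∷ s , _) | _ , inv | pos , refl , apart with maximum x s
... | zero  , K∈ , _ with () ← All.lookup pos K∈
-- By `zeck-value`, `k` is one more than the largest index.
... | suc K , K∈ , bounded = suc (suc K) , s≤s (s≤s z≤n) , cong (_∸ 1) (trans
        (cong suc (sum-↭ (map⁺ F (dense⇒zeck K pos apart bounded K∈ (invariant⇒dense inv apart K∈)))))
        (zeck-value (suc K)))

-- Playing from {1, …, 1}

-- A play of length zero cannot permute its position, hence the final ↭.
_⇝_ : State → State → Set
s ⇝ t = ∃[ u ] (PlayUsing SplittingOrC₁ s u × u ↭ t)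

↭⇒⇝ : ∀ {s t} → s ↭ t → s ⇝ t
↭⇒⇝ p = _ , ε , p

-- The first move absorbs the permutation, as its source matters only up to ↭. In an empty play the
-- final ↭ absorbs it.
↭-⇝-trans : ∀ {s t u} → s ↭ t → t ⇝ u → s ⇝ u
↭-⇝-trans p (_ , ε , q) = _ , ε , ↭-trans p q
↭-⇝-trans p (_ , (m , ok , rest , q , r) ◅ play , q′) =
  _ , (m , ok , rest , ↭-trans p q , r) ◅ play , q′

⇝-trans : ∀ {s t u} → s ⇝ t → t ⇝ u → s ⇝ u
⇝-trans (_ , play , p) t⇝u with _ , play′ , p′ ← ↭-⇝-trans p t⇝u = _ , play ◅◅ play′ , p′

⇝-++ʳ : ∀ r {s t} → s ⇝ t → (s ++ r) ⇝ (t ++ r)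
⇝-++ʳ r (_ , play , p) = _ , gmap (_++ r) frame play , ++⁺ʳ r p
  where
  regroup : ∀ {s} x y → s ↭ x ++ y → s ++ r ↭ x ++ (y ++ r)
  regroup x y p = ↭-trans (++⁺ʳ r p) (↭-reflexive (++-assoc x y r))

  frame : ∀ {s t} → ∃[ m ] (SplittingOrC₁ m × s —[ m ]→ t) →
          ∃[ m ] (SplittingOrC₁ m × (s ++ r) —[ m ]→ (t ++ r))
  frame (m , ok , rest , p , q) =
    m , ok , rest ++ r , regroup (removed m) rest p , regroup (added m) rest q

⇝-++ˡ : ∀ r {s t} → s ⇝ t → (r ++ s) ⇝ (r ++ t)
⇝-++ˡ r {s} {t} s⇝t =
  ↭-⇝-trans (++-comm r s) (⇝-trans (⇝-++ʳ r s⇝t) (↭⇒⇝ (++-comm t r)))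

⇝-move : ∀ m {rest} → SplittingOrC₁ m → (removed m ++ rest) ⇝ (added m ++ rest)
⇝-move m ok = _ , (m , ok , _ , ↭-refl , ↭-refl) ◅ ε , ↭-refl

descending : ℕ → State
descending zero    = []
descending (suc m) = suc m ∷ descending m

-- The two positions have opposite parities and interleave; they exchange roles after each head.
zeck-++-zeck : ∀ K → zeck (suc K) ++ zeck K ↭ descending (suc K)
zeck-++-zeck zero    = ↭-refl
zeck-++-zeck (suc K) = prep _ (↭-trans (++-comm (zeck K) _) (zeck-++-zeck K))

-- Sweeping the lower chips brings a second chip to the top site `3 + j`. Firing it sends one chip
-- to `4 + j` and one to `1 + j`, which completes `descending (suc j)`.
sweep : ∀ j → (1 ∷ descending (2 + j)) ⇝ (3 + j ∷ 1 ∷ descending j)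
sweep zero = ↭-⇝-trans (prep 1 (swap 2 1 ↭-refl)) (⇝-trans (⇝-move C₁ (inj₂ refl))
  (⇝-trans (⇝-move S₂ (inj₁ S₂)) (↭⇒⇝ (swap 1 3 ↭-refl))))
sweep (suc j) = ↭-⇝-trans (swap 1 (3 + j) ↭-refl) (⇝-trans (⇝-++ˡ (3 + j ∷ []) (sweep j))
  (⇝-trans (⇝-move (S (3 + j) (s≤s (s≤s (s≤s z≤n)))) (inj₁ (S _ _)))
    (↭⇒⇝ (↭-trans (swap (1 + j) (4 + j) ↭-refl) (prep (4 + j) (swap (1 + j) 1 ↭-refl))))))

descending⇝zeck : ∀ K → (1 ∷ descending K) ⇝ zeck (suc K)
descending⇝zeck 0             = ↭⇒⇝ ↭-refl
descending⇝zeck 1             = ⇝-move C₁ (inj₂ refl)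
descending⇝zeck (suc (suc K)) = ⇝-trans (sweep K) (⇝-++ˡ (3 + K ∷ []) (descending⇝zeck K))

start-+ : ∀ m n → start (m + n) ≡ start m ++ start n
start-+ zero    n = refl
start-+ (suc m) n = cong (1 ∷_) (start-+ m n)

start⇝zeck : ∀ K → start (value (zeck K)) ⇝ zeck K
start⇝zeck 0 = ↭⇒⇝ ↭-refl
start⇝zeck 1 = ↭⇒⇝ ↭-refl
start⇝zeck (suc (suc K)) = ↭-⇝-trans (↭-reflexive split)
  (⇝-trans (⇝-++ˡ (1 ∷ []) (⇝-trans (⇝-++ʳ _ (start⇝zeck (suc K)))
    (⇝-++ˡ (zeck (suc K)) (start⇝zeck K))))
  (↭-⇝-trans (prep 1 (zeck-++-zeck K)) (descending⇝zeck (suc K))))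
  where
  -- The single extra chip is the `suc` in `zeck-value (suc K)`.
  split : start (value (zeck (2 + K))) ≡ 1 ∷ start (value (zeck (suc K))) ++ start (value (zeck K))
  split = begin
    start (F (2 + K) + value (zeck K))
      ≡⟨ cong (λ v → start (v + value (zeck K))) (zeck-value (suc K)) ⟨
    1 ∷ start (value (zeck (suc K)) + value (zeck K))
      ≡⟨ cong (1 ∷_) (start-+ (value (zeck (suc K))) _) ⟩
    1 ∷ start (value (zeck (suc K))) ++ start (value (zeck K)) ∎
    where open ≡-Reasoning

zeck-finish : ∀ K → CanFinishUsing SplittingOrC₁ (value (zeck K))
zeck-finish K with t , play , p ← start⇝zeck K =
  t , play , Equivalence.from (terminal⇔zeckendorf play)
    ( All-resp-↭ (↭-sym p) (zeck-positive K)
    , sum-↭ (map⁺ F p)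
    , apart-resp-↭ (↭-sym p) (zeck-apart K))

fibonacci⇒finish : ∀ n → ∃[ k ] (2 ≤ k × n ≡ F k ∸ 1) → CanFinishUsing SplittingOrC₁ n
fibonacci⇒finish n (suc K , _ , refl) =
  subst (CanFinishUsing SplittingOrC₁) (cong (_∸ 1) (zeck-value K)) (zeck-finish K)

theorem1p3 : (n : ℕ) → 1 ≤ n → CanFinishUsing SplittingOrC₁ n ⇔ (∃[ k ] (2 ≤ k × n ≡ F k ∸ 1))
theorem1p3 n 1≤n = mk⇔ (finish⇒fibonacci n 1≤n) (fibonacci⇒finish n)
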